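{- Let $\langle L,\leq\rangle$ and $\langle K,\leq\rangle$ be complete lattices and $f:L\to K$ a surjective lattice morphism. Let $O:L\to L$ be an operator and $A:L^2\to L^2$ an approximator of $O$ such that both $O$ and $A$ respect $f$, and let $O_f$ and $A_f$ be their projections on $K$. If $(x,y)$ is the $A$-well-founded fixpoint of $O$, then $(f(x),f(y))$ is the $A_f$-well-founded fixpoint of $O_f$.
   Context: A lattice morphism $f:L\to K$ satisfies $f(\bigvee X)=\bigvee f(X)$ and $f(\bigwedge X)=\bigwedge f(X)$ for all $X\subseteq L$. $L^2$ carries the precision order $(x,y)\leq_p(u,v)$ iff $x\leq u$ and $v\leq y$; write $(x,y)_1=x,(x,y)_2=y$. An approximator of $O$ is a $\leq_p$-monotone $A:L^2\to L^2$ with $A(x,x)_1\leq O(x)\leq A(x,x)_2$ for all $x$, assumed symmetric ($A(x,y)_1=A(y,x)_2$). $O$ respects $f$ if $f(x)=f(y)$ implies $f(O(x))=f(O(y))$; then (for surjective $f$) $O_f$ is the unique operator on $K$ with $O_f\circ f=f\circ O$. With $f^2(x,y)=(f(x),f(y))$, $A$ respects $f$ if $f^2(p)=f^2(q)$ implies $f^2(A(p))=f^2(A(q))$; $A_f$ is the unique operator on $K^2$ with $A_f\circ f^2=f^2\circ A$. For an operator $B$ on a bilattice $M^2$ (and any operator $P$ on $M$), a partial $B$-stable fixpoint is a pair $(x,y)$ with $x=\mathrm{lfp}(B(\cdot,y)_1)$ and $y=\mathrm{lfp}(B(x,\cdot)_2)$; the $B$-well-founded fixpoint of $P$ is the $\leq_p$-least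 (least precise) partial $B$-stable fixpoint. -}

module Defs where

open import Level using (Level; suc)
open import Data.Product using (_×_; _,_; proj₁; proj₂; Σ-syntax; ∃-syntax)
open import Data.Product.Relation.Binary.Pointwise.NonDependent using (_×ₛ_)
open import Data.Product.Function.NonDependent.Setoid using (_×-function_)
open import Function.Bundles using (Func; _⟨$⟩_)
open import Function.Definitions using (StrictlySurjective)
open import Relation.Binary.Bundles using (Setoid; Poset)
open import Relation.Unary using (Pred; _∈_)

private
  variable
    ℓ : Level

-- Subsets are predicates in the universe of the carrier, so that sets such as
-- { x | g x ≤ x } and images of subsets are again subsets.
record CompleteLattice (ℓ : Level) : Set (suc ℓ) where
  field
    poset : Poset ℓ ℓ ℓ

  open Poset poset public

  setoid : Setoid ℓ ℓ
  setoid = Eq.setoid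

  field
    ⋁ : Pred Carrier ℓ → Carrier
    ⋀ : Pred Carrier ℓ → Carrier
    ⋁-upper    : ∀ (X : Pred Carrier ℓ) {x} → x ∈ X → x ≤ ⋁ X
    ⋁-least    : ∀ (X : Pred Carrier ℓ) {u} → (∀ {x} → x ∈ X → x ≤ u) → ⋁ X ≤ u
    ⋀-lower    : ∀ (X : Pred Carrier ℓ) {x} → x ∈ X → ⋀ X ≤ x
    ⋀-greatest : ∀ (X : Pred Carrier ℓ) {l} → (∀ {x} → x ∈ X → l ≤ x) → l ≤ ⋀ X

-- Equality on a lattice is the setoid equality of its poset, hence all maps
-- are required to be congruent.
Operator : Setoid ℓ ℓ → Set ℓ
Operator S = Func S S

module _ {S T : Setoid ℓ ℓ} (f : Func S T) where
  private
    module S = Setoid S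
    module T = Setoid T

  image : Pred S.Carrier ℓ → Pred T.Carrier ℓ
  image X y = ∃[ x ] (x ∈ X × f ⟨$⟩ x T.≈ y)

  IsSurjective : Set ℓ
  IsSurjective = StrictlySurjective T._≈_ (f ⟨$⟩_)

  Respects : Operator S → Set ℓ
  Respects O = ∀ x y → f ⟨$⟩ x T.≈ f ⟨$⟩ y →
               f ⟨$⟩ (O ⟨$⟩ x) T.≈ f ⟨$⟩ (O ⟨$⟩ y)

  -- The defining equation P ∘ f = f ∘ O of the projection of O along f; see
  -- projection-exists and projection-unique.
  IsProjection : Operator S → Operator T → Set ℓ
  IsProjection O P = ∀ x → P ⟨$⟩ (f ⟨$⟩ x) T.≈ f ⟨$⟩ (O ⟨$⟩ x)

  projection-exists : IsSurjective → (O : Operator S) → Respects O →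
                      Σ[ P ∈ Operator T ] IsProjection O P
  projection-exists surj O resp =
    record
      { to   = λ y → f ⟨$⟩ (O ⟨$⟩ proj₁ (surj y))
      ; cong = λ {y} {z} y≈z → resp _ _
          (T.trans (proj₂ (surj y)) (T.trans y≈z (T.sym (proj₂ (surj z)))))
      }
    , λ x → resp _ _ (proj₂ (surj (f ⟨$⟩ x)))

  projection-unique : IsSurjective → (O : Operator S) (P Q : Operator T) →
                      IsProjection O P → IsProjection O Q →
                      ∀ y → P ⟨$⟩ y T.≈ Q ⟨$⟩ y
  projection-unique surj O P Q p q y with surj y
  ... | x , fx≈y =
    T.trans (Func.cong P (T.sym fx≈y))
      (T.trans (p x) (T.trans (T.sym (q x)) (Func.cong Q fx≈y)))

_² : {S T : Setoid ℓ ℓ} → Func S T → Func (S ×ₛ S) (T ×ₛ T)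
f ² = f ×-function f

record IsLatticeMorphism (L K : CompleteLattice ℓ)
         (f : Func (CompleteLattice.setoid L) (CompleteLattice.setoid K)) : Set (suc ℓ) where
  private
    module L = CompleteLattice L
    module K = CompleteLattice K
  field
    preserves-⋁ : ∀ (X : Pred L.Carrier ℓ) → f ⟨$⟩ L.⋁ X K.≈ K.⋁ (image f X)
    preserves-⋀ : ∀ (X : Pred L.Carrier ℓ) → f ⟨$⟩ L.⋀ X K.≈ K.⋀ (image f X)

module _ (L : CompleteLattice ℓ) where
  open CompleteLattice L

  bilattice : Setoid ℓ ℓ
  bilattice = setoid ×ₛ setoid

  infix 4 _≤ₚ_
  _≤ₚ_ : Carrier × Carrier → Carrier × Carrier → Set ℓ
  (x , y) ≤ₚ (u , v) = x ≤ u × v ≤ y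

  record IsApproximator (A : Operator bilattice) (O : Operator setoid) : Set ℓ where
    field
      monotone  : ∀ p q → p ≤ₚ q → A ⟨$⟩ p ≤ₚ A ⟨$⟩ q
      lower     : ∀ x → proj₁ (A ⟨$⟩ (x , x)) ≤ O ⟨$⟩ x
      upper     : ∀ x → O ⟨$⟩ x ≤ proj₂ (A ⟨$⟩ (x , x))
      symmetric : ∀ x y → proj₁ (A ⟨$⟩ (x , y)) ≈ proj₂ (A ⟨$⟩ (y , x))

  -- IsLfp g x renders "x = lfp g".
  IsLfp : (Carrier → Carrier) → Carrier → Set ℓ
  IsLfp g x = g x ≈ x × (∀ z → g z ≈ z → x ≤ z)

  IsPartialStableFixpoint : Operator bilattice → Carrier × Carrier → Set ℓ
  IsPartialStableFixpoint B (x , y) =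
    IsLfp (λ z → proj₁ (B ⟨$⟩ (z , y))) x × IsLfp (λ z → proj₂ (B ⟨$⟩ (x , z))) y

  -- "p is the B-well-founded fixpoint of P".  The notion depends on B only;
  -- P is an argument because the terminology names it.
  IsWellFoundedFixpoint : Operator bilattice → Operator setoid → Carrier × Carrier → Set ℓ
  IsWellFoundedFixpoint B P p =
    IsPartialStableFixpoint B p × (∀ q → IsPartialStableFixpoint B q → p ≤ₚ q)

{-# OPTIONS --safe #-}

-- A monotone g on L that projects to h on K satisfies f (lfp g) = lfp h: if h z = z, then
-- the largest a with f a ≤ z is a prefixpoint of g, hence lies above lfp g.  Applied to the
-- components of A this shows that f² maps partial stable fixpoints to partial stable fixpoints.
--
-- The well-founded fixpoint (x , y) is the ≤ₚ-least fixpoint of the stable operator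
-- Φ (a , b) = (lfp A(·,b)₁ , lfp A(a,·)₂), so it lies below every ≤ₚ-prefixpoint of Φ.
-- Given a partial Aᶠ-stable fixpoint (u , v), the pair formed by the largest a with f a ≤ u
-- and the least b with v ≤ f b is such a prefixpoint, because f² maps it to (u , v) and
-- f² ∘ Φ = Φᶠ ∘ f².
module Submission where

open import Defs
open import Data.Product using (_×_; _,_; proj₁; proj₂; ∃-syntax)
open import Data.Product.Relation.Binary.Pointwise.NonDependent using (×-poset)
open import Function.Bundles using (Func; _⟨$⟩_)
open import Level using (Level)
import Relation.Binary.Construct.Flip.EqAndOrd as Flip
open import Relation.Unary using (Pred; _∈_)

private
  variable
    ℓ : Level

module _ (L : CompleteLattice ℓ) where
  open CompleteLattice L

  Monotone : (Carrier → Carrier) → Set ℓ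
  Monotone g = ∀ {x y} → x ≤ y → g x ≤ g y

  prefixpoints : (Carrier → Carrier) → Pred Carrier ℓ
  prefixpoints g x = g x ≤ x

  -- Knaster-Tarski: for monotone `g` the meet of all prefixpoints is the least fixpoint.
  lfp : (Carrier → Carrier) → Carrier
  lfp g = ⋀ (prefixpoints g)

module _ (L : CompleteLattice ℓ) {g : CompleteLattice.Carrier L → CompleteLattice.Carrier L}
         (g-mono : Monotone L g) where
  open CompleteLattice L

  lfp-prefixpoint : g (lfp L g) ≤ lfp L g
  lfp-prefixpoint = ⋀-greatest (prefixpoints L g) λ {x} gx≤x →
    trans (g-mono (⋀-lower (prefixpoints L g) gx≤x)) gx≤x

  lfp-isLfp : IsLfp L g (lfp L g)
  lfp-isLfp =
      antisym lfp-prefixpoint (⋀-lower (prefixpoints L g) (g-mono lfp-prefixpoint))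
    , λ z gz≈z → ⋀-lower (prefixpoints L g) (reflexive gz≈z)

  -- `IsLfp` compares `x` with fixpoints only; the detour through `lfp L g` extends this to
  -- prefixpoints, which is what the adjoints of `f` produce.
  isLfp⇒≤prefixpoint : ∀ {x a} → IsLfp L g x → g a ≤ a → x ≤ a
  isLfp⇒≤prefixpoint (_ , least) ga≤a =
    trans (least _ (proj₁ lfp-isLfp)) (⋀-lower (prefixpoints L g) ga≤a)

  isLfp⇒≈lfp : ∀ {x} → IsLfp L g x → lfp L g ≈ x
  isLfp⇒≈lfp (gx≈x , least) =
    antisym (proj₂ lfp-isLfp _ gx≈x) (least _ (proj₁ lfp-isLfp))

  ≈lfp⇒isLfp : ∀ {x} → lfp L g ≈ x → IsLfp L g x
  ≈lfp⇒isLfp lfp≈x =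
      -- `g` is a bare function, so monotonicity with antisymmetry stands in for congruence.
      antisym (trans (g-mono (reflexive (Eq.sym lfp≈x))) (trans lfp-prefixpoint (reflexive lfp≈x)))
              (trans (reflexive (Eq.sym lfp≈x))
                (trans (reflexive (Eq.sym (proj₁ lfp-isLfp))) (g-mono (reflexive lfp≈x))))
    , λ z gz≈z → trans (reflexive (Eq.sym lfp≈x)) (proj₂ lfp-isLfp z gz≈z)

module _ (L : CompleteLattice ℓ) where
  open CompleteLattice L

  lfp-mono : ∀ {g h : Carrier → Carrier} → (∀ z → g z ≤ h z) → lfp L g ≤ lfp L h
  lfp-mono {g} {h} g≤h = ⋀-greatest (prefixpoints L h) λ {x} hx≤x →
    ⋀-lower (prefixpoints L g) (trans (g≤h x) hx≤x)

-- Flipping the second factor makes the order `≤ₚ`, so the lemmas on least fixpoints apply to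
-- `stable`.
precisionLattice : CompleteLattice ℓ → CompleteLattice ℓ
precisionLattice L = record
  { poset      = ×-poset poset (Flip.poset poset)
  ; ⋁          = λ X → ⋁ (firsts X) , ⋀ (seconds X)
  ; ⋀          = λ X → ⋀ (firsts X) , ⋁ (seconds X)
  ; ⋁-upper    = λ X p∈X → ⋁-upper (firsts X) (_ , p∈X) , ⋀-lower (seconds X) (_ , p∈X)
  ; ⋁-least    = λ X bound → ⋁-least (firsts X) (λ (_ , p∈X) → proj₁ (bound p∈X))
                           , ⋀-greatest (seconds X) (λ (_ , p∈X) → proj₂ (bound p∈X))
  ; ⋀-lower    = λ X p∈X → ⋀-lower (firsts X) (_ , p∈X) , ⋁-upper (seconds X) (_ , p∈X)
  ; ⋀-greatest = λ X bound → ⋀-greatest (firsts X) (λ (_ , p∈X) → proj₁ (bound p∈X))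
                           , ⋁-least (seconds X) (λ (_ , p∈X) → proj₂ (bound p∈X))
  }
  where
  open CompleteLattice L
  firsts seconds : Pred (Carrier × Carrier) _ → Pred Carrier _
  firsts  X x = ∃[ y ] (x , y) ∈ X
  seconds X y = ∃[ x ] (x , y) ∈ X

module _ (L : CompleteLattice ℓ) (A : Operator (bilattice L)) where
  open CompleteLattice L

  lowerAt upperAt : Carrier → Carrier → Carrier
  lowerAt y z = proj₁ (A ⟨$⟩ (z , y))
  upperAt x z = proj₂ (A ⟨$⟩ (x , z))

  stable : Carrier × Carrier → Carrier × Carrier
  stable (x , y) = lfp L (lowerAt y) , lfp L (upperAt x)

module _ (L : CompleteLattice ℓ) {A : Operator (bilattice L)}
         (A-mono : ∀ p q → _≤ₚ_ L p q → _≤ₚ_ L (A ⟨$⟩ p) (A ⟨$⟩ q)) where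
  open CompleteLattice L

  lowerAt-mono : ∀ y → Monotone L (lowerAt L A y)
  lowerAt-mono y z≤w = proj₁ (A-mono _ _ (z≤w , refl))

  -- Enlarging `z` makes `(x , z)` less precise, which in turn enlarges the second component of its
  -- value: the two reversals cancel.
  upperAt-mono : ∀ x → Monotone L (upperAt L A x)
  upperAt-mono x z≤w = proj₂ (A-mono _ _ (refl , z≤w))

  stable-mono : Monotone (precisionLattice L) (stable L A)
  stable-mono (x≤u , v≤y) =
      lfp-mono L (λ z → proj₁ (A-mono _ _ (refl , v≤y)))
    , lfp-mono L (λ z → proj₂ (A-mono _ _ (x≤u , refl)))

  -- Least fixpoints are unique, so partial stable fixpoints are exactly the fixpoints of `stable`.
  wellFounded⇒isLfp-stable : ∀ {O p} → IsWellFoundedFixpoint L A O p →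
                             IsLfp (precisionLattice L) (stable L A) p
  wellFounded⇒isLfp-stable {p = x , y} ((x-lfp , y-lfp) , least) =
      (isLfp⇒≈lfp L (lowerAt-mono y) x-lfp , isLfp⇒≈lfp L (upperAt-mono x) y-lfp)
    , λ (u , v) (u-eq , v-eq) → least (u , v)
        (≈lfp⇒isLfp L (lowerAt-mono v) u-eq , ≈lfp⇒isLfp L (upperAt-mono u) v-eq)

module _ (L K : CompleteLattice ℓ)
         (f : Func (CompleteLattice.setoid L) (CompleteLattice.setoid K))
         (morphism : IsLatticeMorphism L K f) where
  private
    module L = CompleteLattice L
    module K = CompleteLattice K
  open IsLatticeMorphism morphism

  -- `y` is the join of its down-set, and `f` preserves that join.
  morphism-mono : ∀ {x y} → x L.≤ y → f ⟨$⟩ x K.≤ f ⟨$⟩ y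
  morphism-mono {x} {y} x≤y =
    K.trans (K.⋁-upper (image f ↓y) (x , x≤y , K.Eq.refl))
      (K.reflexive (K.Eq.trans (K.Eq.sym (preserves-⋁ ↓y)) (Func.cong f ⋁↓y≈y)))
    where
    ↓y : Pred L.Carrier _
    ↓y = L._≤ y
    ⋁↓y≈y : L.⋁ ↓y L.≈ y
    ⋁↓y≈y = L.antisym (L.⋁-least ↓y (λ z≤y → z≤y)) (L.⋁-upper ↓y L.refl)

  below above : K.Carrier → Pred L.Carrier ℓ
  below u a = f ⟨$⟩ a K.≤ u
  above v b = v K.≤ f ⟨$⟩ b

  -- The right and left adjoints of `f`; preservation of joins and of meets, respectively, makes
  -- them so.
  upperAdjoint lowerAdjoint : K.Carrier → L.Carrier
  upperAdjoint u = L.⋁ (below u)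
  lowerAdjoint v = L.⋀ (above v)

  f∘upperAdjoint≤ : ∀ u → f ⟨$⟩ upperAdjoint u K.≤ u
  f∘upperAdjoint≤ u = K.trans (K.reflexive (preserves-⋁ (below u)))
    (K.⋁-least _ λ (_ , fa≤u , fa≈k) → K.trans (K.reflexive (K.Eq.sym fa≈k)) fa≤u)

  ≤f∘lowerAdjoint : ∀ v → v K.≤ f ⟨$⟩ lowerAdjoint v
  ≤f∘lowerAdjoint v = K.trans
    (K.⋀-greatest _ λ (_ , v≤fb , fb≈k) → K.trans v≤fb (K.reflexive fb≈k))
    (K.reflexive (K.Eq.sym (preserves-⋀ (above v))))

  module _ (surj : IsSurjective f) where

    f∘upperAdjoint : ∀ u → f ⟨$⟩ upperAdjoint u K.≈ u
    f∘upperAdjoint u with surj u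
    ... | a , fa≈u = K.antisym (f∘upperAdjoint≤ u)
      (K.trans (K.reflexive (K.Eq.sym fa≈u))
        (morphism-mono (L.⋁-upper (below u) (K.reflexive fa≈u))))

    f∘lowerAdjoint : ∀ v → f ⟨$⟩ lowerAdjoint v K.≈ v
    f∘lowerAdjoint v with surj v
    ... | b , fb≈v = K.antisym
      (K.trans (morphism-mono (L.⋀-lower (above v) (K.reflexive (K.Eq.sym fb≈v))))
        (K.reflexive fb≈v))
      (≤f∘lowerAdjoint v)

    f-preserves-isLfp : ∀ {g : L.Carrier → L.Carrier} {h : K.Carrier → K.Carrier} →
      Monotone L g → (∀ {u v} → u K.≈ v → h u K.≈ h v) →
      (∀ z → h (f ⟨$⟩ z) K.≈ f ⟨$⟩ g z) →
      ∀ {x} → IsLfp L g x → IsLfp K h (f ⟨$⟩ x)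
    f-preserves-isLfp {g} {h} g-mono h-cong h∘f≈f∘g {x} x-lfp =
        K.Eq.trans (h∘f≈f∘g x) (Func.cong f (proj₁ x-lfp))
      , λ z hz≈z → K.trans
          (morphism-mono (isLfp⇒≤prefixpoint L g-mono x-lfp
            (L.⋁-upper (below z) (K.reflexive (fg≈z z hz≈z)))))
          (f∘upperAdjoint≤ z)
      where
      -- `g` maps the fibre over a fixpoint `z` of `h` into itself, and `upperAdjoint z` is the
      -- largest element of that fibre.
      fg≈z : ∀ z → h z K.≈ z → f ⟨$⟩ g (upperAdjoint z) K.≈ z
      fg≈z z hz≈z = K.Eq.trans (K.Eq.sym (h∘f≈f∘g _))
        (K.Eq.trans (h-cong (f∘upperAdjoint z)) hz≈z)

    module _ (A : Operator (bilattice L))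
             (A-mono : ∀ p q → _≤ₚ_ L p q → _≤ₚ_ L (A ⟨$⟩ p) (A ⟨$⟩ q))
             (Aᶠ : Operator (bilattice K)) (Aᶠ-proj : IsProjection (f ²) A Aᶠ) where

      -- Having `v` only equal to `f ⟨$⟩ y` allows both `v = f ⟨$⟩ y` and `y = lowerAdjoint v`.
      f-lowerAt-isLfp : ∀ {y v} → f ⟨$⟩ y K.≈ v → ∀ {x} →
        IsLfp L (lowerAt L A y) x → IsLfp K (lowerAt K Aᶠ v) (f ⟨$⟩ x)
      f-lowerAt-isLfp fy≈v = f-preserves-isLfp (lowerAt-mono L {A} A-mono _)
        (λ u≈w → proj₁ (Func.cong Aᶠ (u≈w , K.Eq.refl)))
        (λ z → K.Eq.trans (proj₁ (Func.cong Aᶠ (K.Eq.refl , K.Eq.sym fy≈v)))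
                          (proj₁ (Aᶠ-proj (z , _))))

      f-upperAt-isLfp : ∀ {x u} → f ⟨$⟩ x K.≈ u → ∀ {y} →
        IsLfp L (upperAt L A x) y → IsLfp K (upperAt K Aᶠ u) (f ⟨$⟩ y)
      f-upperAt-isLfp fx≈u = f-preserves-isLfp (upperAt-mono L {A} A-mono _)
        (λ v≈w → proj₂ (Func.cong Aᶠ (K.Eq.refl , v≈w)))
        (λ z → K.Eq.trans (proj₂ (Func.cong Aᶠ (K.Eq.sym fx≈u , K.Eq.refl)))
                          (proj₂ (Aᶠ-proj (_ , z))))

      adjoints-prefixpoint : ∀ {u v} → IsPartialStableFixpoint K Aᶠ (u , v) →
        let q = upperAdjoint u , lowerAdjoint v in _≤ₚ_ L (stable L A q) q
      adjoints-prefixpoint {u} {v} ((u-fix , u-least) , (v-fix , v-least)) =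
          -- One inequality in `K` suffices for each component: the image of the first is a least
          -- fixpoint, hence below `u`; the image of the second is a fixpoint, hence above the least
          -- one `v`.
          L.⋁-upper (below u) (proj₂ fS-lfp u u-fix)
        , L.⋀-lower (above v) (v-least _ (proj₁ fT-lfp))
        where
        fS-lfp = f-lowerAt-isLfp (f∘lowerAdjoint v) (lfp-isLfp L (lowerAt-mono L {A} A-mono _))
        fT-lfp = f-upperAt-isLfp (f∘upperAdjoint u) (lfp-isLfp L (upperAt-mono L {A} A-mono _))

theorem3p4 : {ℓ : Level} (L K : CompleteLattice ℓ)
    (f : Func (CompleteLattice.setoid L) (CompleteLattice.setoid K)) →
    IsLatticeMorphism L K f → IsSurjective f →
    (O : Operator (CompleteLattice.setoid L)) (A : Operator (bilattice L)) →
    IsApproximator L A O →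
    Respects f O → Respects (f ²) A →
    (Oᶠ : Operator (CompleteLattice.setoid K)) (Aᶠ : Operator (bilattice K)) →
    IsProjection f O Oᶠ → IsProjection (f ²) A Aᶠ →
    (x y : CompleteLattice.Carrier L) →
    IsWellFoundedFixpoint L A O (x , y) →
    IsWellFoundedFixpoint K Aᶠ Oᶠ (f ⟨$⟩ x , f ⟨$⟩ y)
theorem3p4 L K f morphism surj O A approx _ _ Oᶠ Aᶠ _ Aᶠ-proj x y wf@((x-lfp , y-lfp) , _) =
    ( f-lowerAt-isLfp L K f morphism surj A monotone Aᶠ Aᶠ-proj K.Eq.refl x-lfp
    , f-upperAt-isLfp L K f morphism surj A monotone Aᶠ Aᶠ-proj K.Eq.refl y-lfp )
  , λ (u , v) uv-stable →
      let x≤a , b≤y = isLfp⇒≤prefixpoint (precisionLattice L) (stable-mono L {A} monotone)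
                        (wellFounded⇒isLfp-stable L {A} monotone {O} wf)
                        (adjoints-prefixpoint L K f morphism surj A monotone Aᶠ Aᶠ-proj uv-stable)
      -- Both bounds are transposed along the adjunctions: `x ≤ upperAdjoint u` gives `f x ≤ u`, and
      -- `lowerAdjoint v ≤ y` gives `v ≤ f y`.
      in K.trans (morphism-mono L K f morphism x≤a) (f∘upperAdjoint≤ L K f morphism u)
       , K.trans (≤f∘lowerAdjoint L K f morphism v) (morphism-mono L K f morphism b≤y)
  where
  module K = CompleteLattice K
  open IsApproximator approx using (monotone)
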